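{- Let $n,m,k$ and $u_1,\ldots,u_k$ be positive integers. Suppose that there exists a signed group orthogonal design $SOD(n;\,u_1,\ldots,u_k)$ over some signed group $S$ that is equipped with a remrep $\pi: S\to SP_m$ of degree $m$, where $m$ is the order of a Hadamard matrix. Then there is an orthogonal design $OD(mn;\,mu_1,\ldots,mu_k)$.
   Context: A signed group $S$ is a group with a distinguished central element of order two, denoted $-1$ (the unit is denoted $1$). The signed group ring $\mathbb{R}[S]$ consists of the finite sums $\sum r_i s_i$ with $r_i\in\mathbb{R}$, $s_i\in P$, where $P$ is a set of coset representatives of $S$ modulo $\langle -1\rangle$, with the identification $-rs=r(-s)$; addition is termwise and multiplication is by linear extension (i.e. the distinguished element $-1$ is identified with the scalar $-1$). Conjugation on $\mathbb{R}[S]$ is $\overline{\sum r_i s_i}=\sum r_i s_i^{ -1}$. Variables are commuting real indeterminates that commute with elements of $S$ and are fixed by conjugation; for a matrix $A=[a_{ij}]$, $A^*=[\overline{a}_{ji}]$. A signed group orthogonal design $SOD(n;\,u_1,\ldots,u_k)$ over $S$ is a square matrix $X$ of order $n$, each entry of which is $0$ or of the form $\epsilon x_j$ with $\epsilon\in S$, $1\le j\le k$, where $x_1,\ldots,x_k$ are distinct variables, such that $XX^*=\big(\sum_{i=1}^k u_i x_i^2\big)I_n$. An $OD(n;\,u_1,\ldots,u_k)$ (orthogonal design) is an SOD over the trivial signed group $\{1,-1\}$, i.e. with entries from $\{0,\pm x_1,\ldots,\pm x_k\}$. $SP_m$ is the signed group of all monomial $\{0,\pm1\}$-matrices of order $m$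 (exactly one nonzero entry in each row and column), with distinguished element $-I_m$. A signed group homomorphism $\phi:S\to T$ is a group homomorphism with $\phi(-1)=-1$. A remrep (real monomial representation) of degree $m$ of $S$ is a signed group homomorphism $\pi:S\to SP_m$. -}

module Defs where

open import Algebra.Bundles using (CommutativeRing; Group; RawRing)
import Algebra.Definitions.RawMonoid as RawMonoidDefs
open import Algebra.Morphism.Structures using (IsGroupHomomorphism)
import Algebra.Properties.Semiring.Sum as SemiringSum
open import Data.Bool.Base using (if_then_else_)
open import Data.Empty using (⊥-elim)
open import Data.Fin.Base using (Fin; zero; punchIn)
open import Data.Fin.Properties using (_≟_; punchInᵢ≢i)
open import Data.Integer.Base as ℤ using (ℤ; 0ℤ; 1ℤ; -1ℤ; +_)
import Data.Integer.Properties as ℤ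
open import Data.List.Base using (List; []; [_]; _++_; map; cartesianProductWith)
open import Data.Nat.Base as ℕ using (ℕ; suc; NonZero)
import Data.Nat.Properties as ℕ
open import Data.Product using (∃; ∃!; ∃₂; _×_; _,_; proj₁; proj₂)
open import Data.Rational.Base as ℚ using (ℚ; 0ℚ; 1ℚ; ½; Positive)
import Data.Rational.Properties as ℚ
open import Data.Rational.Solver using (module +-*-Solver)
open import Data.Sign.Base as Sign using (Sign)
import Data.Sign.Properties as Sign
open import Data.Sum.Base using (_⊎_; inj₁; inj₂)
open import Data.Vec.Base using (Vec; replicate; zipWith; _[_]≔_)
open import Data.Vec.Functional using (removeAt)
open import Level using (Level; 0ℓ; _⊔_) renaming (suc to lsuc)
open import Relation.Binary.PropositionalEquality as ≡ using (_≡_; _≢_; refl; cong; cong₂; subst)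
open import Relation.Nullary using (¬_; does; yes; no)
open import Relation.Nullary.Decidable using (dec-true; dec-false)

-- d m n tends to 0 as m and n tend to infinity
Null : (ℕ → ℕ → ℚ) → Set
Null d = ∀ ε → .{{Positive ε}} → ∃ λ N → ∀ m n → N ℕ.≤ m → N ℕ.≤ n → ℚ.∣ d m n ∣ ℚ.< ε

private
  Bounded : (ℕ → ℕ → ℚ) → Set
  Bounded d = ∃ λ B → Positive B × ∃ λ N → ∀ m n → N ℕ.≤ m → N ℕ.≤ n → ℚ.∣ d m n ∣ ℚ.≤ B

  module _ where
    open +-*-Solver

    trans-eq : ∀ x y z → (x ℚ.- y) ℚ.+ (y ℚ.- z) ≡ x ℚ.- z
    trans-eq = solve 3 (λ x y z → (x :- y) :+ (y :- z) := x :- z) refl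

    sym-eq : ∀ x y → ℚ.- (y ℚ.- x) ≡ x ℚ.- y
    sym-eq = solve 2 (λ x y → :- (y :- x) := x :- y) refl

    +-eq : ∀ x x′ y y′ → (x ℚ.- x′) ℚ.+ (y ℚ.- y′) ≡ (x ℚ.+ y) ℚ.- (x′ ℚ.+ y′)
    +-eq = solve 4 (λ x x′ y y′ → (x :- x′) :+ (y :- y′) := (x :+ y) :- (x′ :+ y′)) refl

    *-eq : ∀ x x′ y y′ → x ℚ.* (y ℚ.- y′) ℚ.+ y′ ℚ.* (x ℚ.- x′) ≡ x ℚ.* y ℚ.- x′ ℚ.* y′
    *-eq = solve 4 (λ x x′ y y′ → x :* (y :- y′) :+ y′ :* (x :- x′) := x :* y :- x′ :* y′) refl

    neg-eq : ∀ x y → ℚ.- (x ℚ.- y) ≡ (ℚ.- x) ℚ.- (ℚ.- y)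
    neg-eq = solve 2 (λ x y → :- (x :- y) := (:- x) :- (:- y)) refl

    split-eq : ∀ x y → (x ℚ.- y) ℚ.+ y ≡ x
    split-eq = solve 2 (λ x y → (x :- y) :+ y := x) refl

  half : ∀ ε → ½ ℚ.* ε ℚ.+ ½ ℚ.* ε ≡ ε
  half ε = ≡.trans (≡.sym (ℚ.*-distribʳ-+ ε ½ ½)) (ℚ.*-identityˡ ε)

  Null-resp : ∀ {d e} → (∀ m n → d m n ≡ e m n) → Null d → Null e
  Null-resp eq d ε = let N , h = d ε in
    N , λ m n p q → subst (λ z → ℚ.∣ z ∣ ℚ.< ε) (eq m n) (h m n p q)

  Null-neg : ∀ {d} → Null d → Null (λ m n → ℚ.- d m n)
  Null-neg {d} dn ε = let N , h = dn ε in
    N , λ m n p q → subst (ℚ._< ε) (≡.sym (ℚ.∣-p∣≡∣p∣ (d m n))) (h m n p q)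

  Null-flip : ∀ {d} → Null d → Null (λ m n → d n m)
  Null-flip dn ε = let N , h = dn ε in N , λ m n p q → h n m q p

  Null-+ : ∀ {d e} → Null d → Null e → Null (λ m n → d m n ℚ.+ e m n)
  Null-+ {d} {e} dn en ε = M ℕ.⊔ N , λ m n p q → begin-strict
      ℚ.∣ d m n ℚ.+ e m n ∣           ≤⟨ ℚ.∣p+q∣≤∣p∣+∣q∣ (d m n) (e m n) ⟩
      ℚ.∣ d m n ∣ ℚ.+ ℚ.∣ e m n ∣     <⟨ ℚ.+-mono-<
                                          (hd m n (ℕ.m⊔n≤o⇒m≤o M N p) (ℕ.m⊔n≤o⇒m≤o M N q))
                                          (he m n (ℕ.m⊔n≤o⇒n≤o M N p) (ℕ.m⊔n≤o⇒n≤o M N q)) ⟩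
      ½ ℚ.* ε ℚ.+ ½ ℚ.* ε             ≡⟨ half ε ⟩
      ε                               ∎
    where
    open ℚ.≤-Reasoning
    instance
      pos : Positive (½ ℚ.* ε)
      pos = ℚ.pos*pos⇒pos ½ ε
    M = proj₁ (dn (½ ℚ.* ε))
    hd = proj₂ (dn (½ ℚ.* ε))
    N = proj₁ (en (½ ℚ.* ε))
    he = proj₂ (en (½ ℚ.* ε))

  Null-* : ∀ {b d} → Bounded b → Null d → Null (λ m n → b m n ℚ.* d m n)
  Null-* {b} {d} (B , B⁺ , M , hb) dn ε = M ℕ.⊔ N , λ m n p q → begin-strict
      ℚ.∣ b m n ℚ.* d m n ∣           ≡⟨ ℚ.∣p*q∣≡∣p∣*∣q∣ (b m n) (d m n) ⟩
      ℚ.∣ b m n ∣ ℚ.* ℚ.∣ d m n ∣     ≤⟨ ℚ.*-monoʳ-≤-nonNeg ℚ.∣ d m n ∣ {{ℚ.∣-∣-nonNeg (d m n)}}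
                                          (hb m n (ℕ.m⊔n≤o⇒m≤o M N p) (ℕ.m⊔n≤o⇒m≤o M N q)) ⟩
      B ℚ.* ℚ.∣ d m n ∣               <⟨ ℚ.*-monoʳ-<-pos B
                                          (hd m n (ℕ.m⊔n≤o⇒n≤o M N p) (ℕ.m⊔n≤o⇒n≤o M N q)) ⟩
      B ℚ.* (ℚ.1/ B ℚ.* ε)            ≡⟨ ℚ.*-assoc B (ℚ.1/ B) ε ⟨
      B ℚ.* ℚ.1/ B ℚ.* ε              ≡⟨ cong (ℚ._* ε) (ℚ.*-inverseʳ B) ⟩
      1ℚ ℚ.* ε                        ≡⟨ ℚ.*-identityˡ ε ⟩
      ε                               ∎
    where
    open ℚ.≤-Reasoning
    instance
      B-pos : Positive B
      B-pos = B⁺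
      B≢0 : ℚ.NonZero B
      B≢0 = ℚ.pos⇒nonZero B
      1/B-pos : Positive (ℚ.1/ B)
      1/B-pos = ℚ.1/pos⇒pos B
      δ-pos : Positive (ℚ.1/ B ℚ.* ε)
      δ-pos = ℚ.pos*pos⇒pos (ℚ.1/ B) ε
    N = proj₁ (dn (ℚ.1/ B ℚ.* ε))
    hd = proj₂ (dn (ℚ.1/ B ℚ.* ε))

infix 4 _∼_ _≃_

-- x ∼ x  says that x is a Cauchy sequence; between Cauchy sequences, x ∼ y
-- says that their difference tends to zero.
record _∼_ (x y : ℕ → ℚ) : Set where
  constructor mk∼
  field
    null : Null (λ m n → x m ℚ.- y n)
open _∼_

record Real : Set where
  constructor mkReal
  field
    seq    : ℕ → ℚ
    cauchy : seq ∼ seq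
open Real

record _≃_ (x y : Real) : Set where
  constructor mk≃
  field
    seq-∼ : seq x ∼ seq y
open _≃_

private
  ∼-sym : ∀ {x y} → x ∼ y → y ∼ x
  ∼-sym {x} {y} (mk∼ p) = mk∼ (Null-resp (λ m n → sym-eq (y m) (x n)) (Null-neg (Null-flip p)))

  ∼-trans : ∀ {x y z} → x ∼ y → y ∼ z → x ∼ z
  ∼-trans {x} {y} {z} (mk∼ p) (mk∼ q) =
    mk∼ (Null-resp (λ m n → trans-eq (x m) (y n) (z n)) (Null-+ p q′))
    where
    q′ : Null (λ _ n → y n ℚ.- z n)
    q′ ε = let N , h = q ε in N , λ _ n _ b → h n n b b

  ∼-reflˡ : ∀ {x y} → x ∼ y → x ∼ x
  ∼-reflˡ p = ∼-trans p (∼-sym p)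

  bounded : ∀ {x} → x ∼ x → ∃ λ B → Positive B × ∃ λ N → ∀ m → N ℕ.≤ m → ℚ.∣ x m ∣ ℚ.≤ B
  bounded {x} (mk∼ p) = 1ℚ ℚ.+ ℚ.∣ x N ∣ , ℚ.pos+nonNeg⇒pos 1ℚ ℚ.∣ x N ∣ {{ℚ.∣-∣-nonNeg (x N)}} , N ,
    λ m N≤m → begin
      ℚ.∣ x m ∣                         ≡⟨ cong ℚ.∣_∣ (split-eq (x m) (x N)) ⟨
      ℚ.∣ (x m ℚ.- x N) ℚ.+ x N ∣       ≤⟨ ℚ.∣p+q∣≤∣p∣+∣q∣ (x m ℚ.- x N) (x N) ⟩
      ℚ.∣ x m ℚ.- x N ∣ ℚ.+ ℚ.∣ x N ∣   ≤⟨ ℚ.+-monoˡ-≤ ℚ.∣ x N ∣ (ℚ.<⇒≤ (h m N N≤m ℕ.≤-refl)) ⟩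
      1ℚ ℚ.+ ℚ.∣ x N ∣                  ∎
    where
    open ℚ.≤-Reasoning
    N = proj₁ (p 1ℚ)
    h = proj₂ (p 1ℚ)

  +-cong : ∀ {x x′ y y′} → x ∼ x′ → y ∼ y′ → (λ n → x n ℚ.+ y n) ∼ (λ n → x′ n ℚ.+ y′ n)
  +-cong {x} {x′} {y} {y′} (mk∼ p) (mk∼ q) =
    mk∼ (Null-resp (λ m n → +-eq (x m) (x′ n) (y m) (y′ n)) (Null-+ p q))

  -‿cong : ∀ {x x′} → x ∼ x′ → (λ n → ℚ.- x n) ∼ (λ n → ℚ.- x′ n)
  -‿cong {x} {x′} (mk∼ p) = mk∼ (Null-resp (λ m n → neg-eq (x m) (x′ n)) (Null-neg p))

  *-cong : ∀ {x x′ y y′} → x ∼ x′ → y ∼ y′ → (λ n → x n ℚ.* y n) ∼ (λ n → x′ n ℚ.* y′ n)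
  *-cong {x} {x′} {y} {y′} p q =
    mk∼ (Null-resp (λ m n → *-eq (x m) (x′ n) (y m) (y′ n))
      (Null-+ (Null-* bx (null q)) (Null-* by (null p))))
    where
    bx : Bounded (λ m n → x m)
    bx = let B , B⁺ , N , h = bounded (∼-reflˡ p) in B , B⁺ , N , λ m _ a _ → h m a
    by : Bounded (λ m n → y′ n)
    by = let B , B⁺ , N , h = bounded (∼-reflˡ (∼-sym q)) in B , B⁺ , N , λ _ n _ b → h n b

  const-∼ : ∀ q → (λ _ → q) ∼ (λ _ → q)
  const-∼ q = mk∼ λ ε → 0 , λ _ _ _ _ → subst (ℚ._< ε) (cong ℚ.∣_∣ (≡.sym (ℚ.+-inverseʳ q))) (ℚ.positive⁻¹ ε)

  pointwise : ∀ (x y : Real) → (∀ n → seq x n ≡ seq y n) → x ≃ y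
  pointwise x y eq = mk≃ (mk∼ (Null-resp (λ m n → cong (λ z → seq x m ℚ.- z) (eq n)) (null (cauchy x))))

-- Opaque only to keep conversion checking from unfolding Cauchy sequences.
opaque
  ℝ : CommutativeRing 0ℓ 0ℓ
  ℝ = record
    { Carrier = Real
    ; _≈_ = _≃_
    ; _+_ = add
    ; _*_ = mul
    ; -_  = neg
    ; 0#  = zer
    ; 1#  = one
    ; isCommutativeRing = record
      { isRing = record
        { +-isAbelianGroup = record
          { isGroup = record
            { isMonoid = record
              { isSemigroup = record
                { isMagma = record
                  { isEquivalence = record
                    { refl  = λ {x} → mk≃ (cauchy x)
                    ; sym   = λ { (mk≃ p) → mk≃ (∼-sym p) }
                    ; trans = λ { (mk≃ p) (mk≃ q) → mk≃ (∼-trans p q) }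
                    }
                  ; ∙-cong = λ { (mk≃ p) (mk≃ q) → mk≃ (+-cong p q) }
                  }
                ; assoc = λ x y z → pointwise (add (add x y) z) (add x (add y z))
                    λ n → ℚ.+-assoc (seq x n) (seq y n) (seq z n)
                }
              ; identity = (λ x → pointwise (add zer x) x λ n → ℚ.+-identityˡ (seq x n))
                         , (λ x → pointwise (add x zer) x λ n → ℚ.+-identityʳ (seq x n))
              }
            ; inverse = (λ x → pointwise (add (neg x) x) zer λ n → ℚ.+-inverseˡ (seq x n))
                      , (λ x → pointwise (add x (neg x)) zer λ n → ℚ.+-inverseʳ (seq x n))
            ; ⁻¹-cong = λ { (mk≃ p) → mk≃ (-‿cong p) }
            }
          ; comm = λ x y → pointwise (add x y) (add y x)
              λ n → ℚ.+-comm (seq x n) (seq y n)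
          }
        ; *-cong = λ { (mk≃ p) (mk≃ q) → mk≃ (*-cong p q) }
        ; *-assoc = λ x y z → pointwise (mul (mul x y) z) (mul x (mul y z))
            λ n → ℚ.*-assoc (seq x n) (seq y n) (seq z n)
        ; *-identity = (λ x → pointwise (mul one x) x λ n → ℚ.*-identityˡ (seq x n))
                     , (λ x → pointwise (mul x one) x λ n → ℚ.*-identityʳ (seq x n))
        ; distrib =
            (λ x y z → pointwise (mul x (add y z)) (add (mul x y) (mul x z))
              λ n → ℚ.*-distribˡ-+ (seq x n) (seq y n) (seq z n))
          , (λ x y z → pointwise (mul (add y z) x) (add (mul y x) (mul z x))
              λ n → ℚ.*-distribʳ-+ (seq x n) (seq y n) (seq z n))
        }
      ; *-comm = λ x y → pointwise (mul x y) (mul y x)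
          λ n → ℚ.*-comm (seq x n) (seq y n)
      }
    }
    where
    add mul : Real → Real → Real
    add (mkReal x p) (mkReal y q) = mkReal (λ n → x n ℚ.+ y n) (+-cong p q)
    mul (mkReal x p) (mkReal y q) = mkReal (λ n → x n ℚ.* y n) (*-cong p q)
    neg : Real → Real
    neg (mkReal x p) = mkReal (λ n → ℚ.- x n) (-‿cong p)
    zer one : Real
    zer = mkReal (λ _ → 0ℚ) (const-∼ 0ℚ)
    one = mkReal (λ _ → 1ℚ) (const-∼ 1ℚ)

private
  variable
    a c ℓ c′ ℓ′ : Level
    n : ℕ

Matrix : Set a → ℕ → Set a
Matrix A n = Fin n → Fin n → A

_ᵀ : {A : Set a} → Matrix A n → Matrix A n
(A ᵀ) i j = A j i

module MatrixOperations (R : RawRing c ℓ) where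
  open RawRing R
  open RawMonoidDefs +-rawMonoid using (sum)

  infix  4 _≈ᴹ_
  infixl 7 _*ᴹ_ _•_
  infix  8 -ᴹ_

  _≈ᴹ_ : Matrix Carrier n → Matrix Carrier n → Set ℓ
  A ≈ᴹ B = ∀ i j → A i j ≈ B i j

  _*ᴹ_ : Matrix Carrier n → Matrix Carrier n → Matrix Carrier n
  (A *ᴹ B) i j = sum λ l → A i l * B l j

  -ᴹ_ : Matrix Carrier n → Matrix Carrier n
  (-ᴹ A) i j = - A i j

  _•_ : Carrier → Matrix Carrier n → Matrix Carrier n
  (x • A) i j = x * A i j

  1ᴹ : Matrix Carrier n
  1ᴹ i j = if does (i ≟ j) then 1# else 0#

record SignedGroup c ℓ : Set (lsuc (c ⊔ ℓ)) where
  field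
    group : Group c ℓ
  open Group group public
  field
    -1#         : Carrier
    -1#-central : ∀ s → -1# ∙ s ≈ s ∙ -1#
    -1#-square  : -1# ∙ -1# ≈ ε
    -1#≉ε       : ¬ (-1# ≈ ε)

record SignedGroupHomomorphism (S : SignedGroup c ℓ) (T : SignedGroup c′ ℓ′)
                               : Set (c ⊔ ℓ ⊔ c′ ⊔ ℓ′) where
  private
    module S = SignedGroup S
    module T = SignedGroup T
  field
    ⟦_⟧                 : S.Carrier → T.Carrier
    isGroupHomomorphism : IsGroupHomomorphism S.rawGroup T.rawGroup ⟦_⟧
    -1#-homo            : ⟦ S.-1# ⟧ T.≈ T.-1#

trivialSignedGroup : SignedGroup 0ℓ 0ℓ
trivialSignedGroup = record
  { group       = Sign.*-group
  ; -1#         = Sign.-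
  ; -1#-central = Sign.*-comm Sign.-
  ; -1#-square  = refl
  ; -1#≉ε       = λ ()
  }

open MatrixOperations ℤ.+-*-rawRing
  renaming (_≈ᴹ_ to _≈ℤ_; _*ᴹ_ to _*ℤ_; -ᴹ_ to -ℤ_; _•_ to _•ℤ_; 1ᴹ to 1ℤᴹ)

record IsMonomial (A : Matrix ℤ n) : Set where
  field
    entries : ∀ i j → A i j ≡ 0ℤ ⊎ A i j ≡ 1ℤ ⊎ A i j ≡ -1ℤ
    rows    : ∀ i → ∃! _≡_ λ j → A i j ≢ 0ℤ
    columns : ∀ j → ∃! _≡_ λ i → A i j ≢ 0ℤ

record MonomialMatrix (m : ℕ) : Set where
  constructor mkMonomial
  field
    matrix     : Matrix ℤ m
    isMonomial : IsMonomial matrix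
open MonomialMatrix

private
  module ℤSum = SemiringSum (CommutativeRing.semiring ℤ.+-*-commutativeRing)
  open ℤSum using (sum-syntax) renaming (sum to sumℤ)
  open ≡.≡-Reasoning

  -- a sum with at most one nonzero term
  sum-single : (f : Fin n → ℤ) (k : Fin n) → (∀ l → f l ≢ 0ℤ → k ≡ l) → sumℤ f ≡ f k
  sum-single {suc n} f k h = begin
    sumℤ f                                ≡⟨ ℤSum.sum-remove {i = k} f ⟩
    f k ℤ.+ sumℤ (removeAt f k)           ≡⟨ cong (λ z → f k ℤ.+ z) (ℤSum.sum-cong-≗ {n} vanish) ⟩
    f k ℤ.+ sumℤ {n} (λ _ → 0ℤ)           ≡⟨ cong (λ z → f k ℤ.+ z) (ℤSum.sum-replicate-zero n) ⟩
    f k ℤ.+ 0ℤ                            ≡⟨ ℤ.+-identityʳ (f k) ⟩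
    f k                                   ∎
    where
    vanish : ∀ l → f (punchIn k l) ≡ 0ℤ
    vanish l with f (punchIn k l) ℤ.≟ 0ℤ
    ... | yes eq = eq
    ... | no ne = ⊥-elim (punchInᵢ≢i k l (≡.sym (h _ ne)))

  1ℤᴹ-diag : (i : Fin n) → 1ℤᴹ i i ≡ 1ℤ
  1ℤᴹ-diag i rewrite dec-true (i ≟ i) refl = refl

  1ℤᴹ-off : {i j : Fin n} → i ≢ j → 1ℤᴹ i j ≡ 0ℤ
  1ℤᴹ-off {i = i} {j} i≢j rewrite dec-false (i ≟ j) i≢j = refl

  1ℤᴹ-nonzero : {i j : Fin n} → 1ℤᴹ i j ≢ 0ℤ → i ≡ j
  1ℤᴹ-nonzero {i = i} {j} ne with i ≟ j
  ... | yes p = p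
  ... | no _ = ⊥-elim (ne refl)

  *-nonzeroˡ : ∀ x y → x ℤ.* y ≢ 0ℤ → x ≢ 0ℤ
  *-nonzeroˡ _ y ne refl = ne (ℤ.*-zeroˡ y)

  *-nonzeroʳ : ∀ x y → x ℤ.* y ≢ 0ℤ → y ≢ 0ℤ
  *-nonzeroʳ x _ ne refl = ne (ℤ.*-zeroʳ x)

  *-nonzero : ∀ x y → x ≢ 0ℤ → y ≢ 0ℤ → x ℤ.* y ≢ 0ℤ
  *-nonzero x y x≢0 y≢0 eq with ℤ.i*j≡0⇒i≡0∨j≡0 x eq
  ... | inj₁ p = x≢0 p
  ... | inj₂ p = y≢0 p

  assocᴹ : (A B C : Matrix ℤ n) → ((A *ℤ B) *ℤ C) ≈ℤ (A *ℤ (B *ℤ C))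
  assocᴹ {n} A B C i j = begin
    ∑[ l < n ] (∑[ k < n ] (A i k ℤ.* B k l) ℤ.* C l j)
      ≡⟨ ℤSum.sum-cong-≗ (λ l → ℤSum.*-distribʳ-sum (C l j) (λ k → A i k ℤ.* B k l)) ⟩
    ∑[ l < n ] ∑[ k < n ] (A i k ℤ.* B k l ℤ.* C l j)
      ≡⟨ ℤSum.∑-comm (λ l k → A i k ℤ.* B k l ℤ.* C l j) ⟩
    ∑[ k < n ] ∑[ l < n ] (A i k ℤ.* B k l ℤ.* C l j)
      ≡⟨ ℤSum.sum-cong-≗ (λ k → ℤSum.sum-cong-≗ λ l → ℤ.*-assoc (A i k) (B k l) (C l j)) ⟩
    ∑[ k < n ] ∑[ l < n ] (A i k ℤ.* (B k l ℤ.* C l j))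
      ≡⟨ ℤSum.sum-cong-≗ (λ k → ℤSum.*-distribˡ-sum (A i k) (λ l → B k l ℤ.* C l j)) ⟨
    ∑[ k < n ] (A i k ℤ.* ∑[ l < n ] (B k l ℤ.* C l j)) ∎

  identityˡᴹ : (A : Matrix ℤ n) → (1ℤᴹ *ℤ A) ≈ℤ A
  identityˡᴹ A i j = begin
    sumℤ (λ l → 1ℤᴹ i l ℤ.* A l j)
      ≡⟨ sum-single _ i (λ l ne → 1ℤᴹ-nonzero (*-nonzeroˡ (1ℤᴹ i l) (A l j) ne)) ⟩
    1ℤᴹ i i ℤ.* A i j
      ≡⟨ cong (ℤ._* A i j) (1ℤᴹ-diag i) ⟩
    1ℤ ℤ.* A i j
      ≡⟨ ℤ.*-identityˡ (A i j) ⟩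
    A i j ∎

  identityʳᴹ : (A : Matrix ℤ n) → (A *ℤ 1ℤᴹ) ≈ℤ A
  identityʳᴹ A i j = begin
    sumℤ (λ l → A i l ℤ.* 1ℤᴹ l j)
      ≡⟨ sum-single _ j (λ l ne → ≡.sym (1ℤᴹ-nonzero (*-nonzeroʳ (A i l) (1ℤᴹ l j) ne))) ⟩
    A i j ℤ.* 1ℤᴹ j j
      ≡⟨ cong (A i j ℤ.*_) (1ℤᴹ-diag j) ⟩
    A i j ℤ.* 1ℤ
      ≡⟨ ℤ.*-identityʳ (A i j) ⟩
    A i j ∎

  module _ {A : Matrix ℤ n} (mono : IsMonomial A) where
    open IsMonomial mono

    support : Fin n → Fin n
    support i = proj₁ (rows i)

    support-nonzero : ∀ i → A i (support i) ≢ 0ℤ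
    support-nonzero i = proj₁ (proj₂ (rows i))

    *-monomialˡ : (B : Matrix ℤ n) → ∀ i j → (A *ℤ B) i j ≡ A i (support i) ℤ.* B (support i) j
    *-monomialˡ B i j = sum-single _ (support i)
      λ l ne → proj₂ (proj₂ (rows i)) (*-nonzeroˡ (A i l) (B l j) ne)

    entry-square : ∀ i j → A i j ≢ 0ℤ → A i j ℤ.* A i j ≡ 1ℤ
    entry-square i j ne with A i j | entries i j
    ... | _ | inj₁ refl        = ⊥-elim (ne refl)
    ... | _ | inj₂ (inj₁ refl) = refl
    ... | _ | inj₂ (inj₂ refl) = refl

    ᵀ-inverseʳ : (A *ℤ (A ᵀ)) ≈ℤ 1ℤᴹ
    ᵀ-inverseʳ i i′ with *-monomialˡ (A ᵀ) i i′
    ... | eq with i ≟ i′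
    ... | yes refl = ≡.trans eq (entry-square i (support i) (support-nonzero i))
    ... | no i≢i′  with A i′ (support i) ℤ.≟ 0ℤ
    ... | yes z = ≡.trans eq (≡.trans (cong (A i (support i) ℤ.*_) z) (ℤ.*-zeroʳ (A i (support i))))
    ... | no nz = let _ , _ , unique = columns (support i) in
      ⊥-elim (i≢i′ (≡.trans (≡.sym (unique (support-nonzero i))) (unique nz)))

    ᵀ-monomial : IsMonomial (A ᵀ)
    ᵀ-monomial = record { entries = λ i j → entries j i ; rows = columns ; columns = rows }

    -ᴹ-monomial : IsMonomial (-ℤ A)
    -ᴹ-monomial = record
      { entries = λ i j → negEntry (entries i j)
      ; rows    = λ i → let j , nz , unique = rows i in
          j , (λ eq → nz (neg≡0 eq)) , λ ne → unique λ z → ne (cong ℤ.-_ z)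
      ; columns = λ j → let i , nz , unique = columns j in
          i , (λ eq → nz (neg≡0 eq)) , λ ne → unique λ z → ne (cong ℤ.-_ z)
      }
      where
      neg≡0 : ∀ {x} → ℤ.- x ≡ 0ℤ → x ≡ 0ℤ
      neg≡0 {x} eq = ≡.trans (≡.sym (ℤ.neg-involutive x)) (cong ℤ.-_ eq)
      negEntry : ∀ {x} → x ≡ 0ℤ ⊎ x ≡ 1ℤ ⊎ x ≡ -1ℤ → ℤ.- x ≡ 0ℤ ⊎ ℤ.- x ≡ 1ℤ ⊎ ℤ.- x ≡ -1ℤ
      negEntry (inj₁ refl)        = inj₁ refl
      negEntry (inj₂ (inj₁ refl)) = inj₂ (inj₂ refl)
      negEntry (inj₂ (inj₂ refl)) = inj₂ (inj₁ refl)

  *-monomial : {A B : Matrix ℤ n} → IsMonomial A → IsMonomial B → IsMonomial (A *ℤ B)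
  *-monomial {n} {A} {B} mA mB = record
    { entries = λ i j → subst Entry (≡.sym (*-monomialˡ mA B i j))
        (mulEntry (MA.entries i (σ i)) (MB.entries (σ i) j))
    ; rows    = λ i → τ (σ i)
        , (λ eq → *-nonzero _ _ (support-nonzero mA i) (support-nonzero mB (σ i))
                    (≡.trans (≡.sym (*-monomialˡ mA B i (τ (σ i)))) eq))
        , λ {j} ne → proj₂ (proj₂ (MB.rows (σ i)))
            (*-nonzeroʳ (A i (σ i)) _ λ z → ne (≡.trans (*-monomialˡ mA B i j) z))
    ; columns = column
    }
    where
    module MA = IsMonomial mA
    module MB = IsMonomial mB
    σ = support mA
    τ = support mB
    Entry : ℤ → Set
    Entry x = x ≡ 0ℤ ⊎ x ≡ 1ℤ ⊎ x ≡ -1ℤ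
    mulEntry : ∀ {x y} → Entry x → Entry y → Entry (x ℤ.* y)
    mulEntry {y = y} (inj₁ refl)       _                  = inj₁ (ℤ.*-zeroˡ y)
    mulEntry (inj₂ (inj₁ refl)) (inj₁ refl)        = inj₁ refl
    mulEntry (inj₂ (inj₁ refl)) (inj₂ (inj₁ refl)) = inj₂ (inj₁ refl)
    mulEntry (inj₂ (inj₁ refl)) (inj₂ (inj₂ refl)) = inj₂ (inj₂ refl)
    mulEntry (inj₂ (inj₂ refl)) (inj₁ refl)        = inj₁ refl
    mulEntry (inj₂ (inj₂ refl)) (inj₂ (inj₁ refl)) = inj₂ (inj₂ refl)
    mulEntry (inj₂ (inj₂ refl)) (inj₂ (inj₂ refl)) = inj₂ (inj₁ refl)
    column : ∀ j → ∃! _≡_ λ i → (A *ℤ B) i j ≢ 0ℤ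
    column j with MB.columns j
    ... | l , l-nz , l-unique with MA.columns l
    ... | i , i-nz , i-unique = i , nz , unique
      where
      nz : (A *ℤ B) i j ≢ 0ℤ
      nz eq with proj₂ (proj₂ (MA.rows i)) i-nz
      ... | refl = *-nonzero _ _ i-nz l-nz (≡.trans (≡.sym (*-monomialˡ mA B i j)) eq)
      unique : ∀ {i′} → (A *ℤ B) i′ j ≢ 0ℤ → i ≡ i′
      unique {i′} ne with l-unique (*-nonzeroʳ (A i′ (σ i′)) (B (σ i′) j)
                            λ z → ne (≡.trans (*-monomialˡ mA B i′ j) z))
      ... | refl = i-unique (support-nonzero mA i′)

  1ᴹ-monomial : IsMonomial (1ℤᴹ {n})
  1ᴹ-monomial = record
    { entries = entry
    ; rows    = λ i → i , diag i , 1ℤᴹ-nonzero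
    ; columns = λ j → j , diag j , λ ne → ≡.sym (1ℤᴹ-nonzero ne)
    }
    where
    entry : (i j : Fin n) → 1ℤᴹ i j ≡ 0ℤ ⊎ 1ℤᴹ i j ≡ 1ℤ ⊎ 1ℤᴹ i j ≡ -1ℤ
    entry i j with i ≟ j
    ... | yes _ = inj₂ (inj₁ refl)
    ... | no _  = inj₁ refl
    diag : (i : Fin n) → 1ℤᴹ i i ≢ 0ℤ
    diag i eq with ≡.trans (≡.sym (1ℤᴹ-diag i)) eq
    ... | ()

  *ℤ-cong : {A A′ B B′ : Matrix ℤ n} → A ≈ℤ A′ → B ≈ℤ B′ → (A *ℤ B) ≈ℤ (A′ *ℤ B′)
  *ℤ-cong p q i j = ℤSum.sum-cong-≗ λ l → cong₂ ℤ._*_ (p i l) (q l j)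

  neg-*ˡ : (A B : Matrix ℤ n) → ((-ℤ A) *ℤ B) ≈ℤ (-ℤ (A *ℤ B))
  neg-*ˡ A B i j = begin
    sumℤ (λ l → ℤ.- A i l ℤ.* B l j)
      ≡⟨ ℤSum.sum-cong-≗ (λ l → ≡.trans (≡.sym (ℤ.neg-distribˡ-* (A i l) (B l j))) (≡.sym (ℤ.-1*i≡-i (A i l ℤ.* B l j)))) ⟩
    sumℤ (λ l → -1ℤ ℤ.* (A i l ℤ.* B l j))
      ≡⟨ ℤSum.*-distribˡ-sum -1ℤ (λ l → A i l ℤ.* B l j) ⟨
    -1ℤ ℤ.* (A *ℤ B) i j
      ≡⟨ ℤ.-1*i≡-i ((A *ℤ B) i j) ⟩
    ℤ.- (A *ℤ B) i j ∎

  neg-*ʳ : (A B : Matrix ℤ n) → (A *ℤ (-ℤ B)) ≈ℤ (-ℤ (A *ℤ B))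
  neg-*ʳ A B i j = begin
    sumℤ (λ l → A i l ℤ.* ℤ.- B l j)
      ≡⟨ ℤSum.sum-cong-≗ (λ l → ≡.trans (≡.sym (ℤ.neg-distribʳ-* (A i l) (B l j))) (≡.sym (ℤ.-1*i≡-i (A i l ℤ.* B l j)))) ⟩
    sumℤ (λ l → -1ℤ ℤ.* (A i l ℤ.* B l j))
      ≡⟨ ℤSum.*-distribˡ-sum -1ℤ (λ l → A i l ℤ.* B l j) ⟨
    -1ℤ ℤ.* (A *ℤ B) i j
      ≡⟨ ℤ.-1*i≡-i ((A *ℤ B) i j) ⟩
    ℤ.- (A *ℤ B) i j ∎

monomialGroup : ℕ → Group 0ℓ 0ℓ
monomialGroup m = record
  { Carrier = MonomialMatrix m
  ; _≈_ = λ A B → matrix A ≈ℤ matrix B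
  ; _∙_ = λ A B → mkMonomial (matrix A *ℤ matrix B) (*-monomial (isMonomial A) (isMonomial B))
  ; ε   = mkMonomial 1ℤᴹ 1ᴹ-monomial
  ; _⁻¹ = λ A → mkMonomial (matrix A ᵀ) (ᵀ-monomial (isMonomial A))
  ; isGroup = record
    { isMonoid = record
      { isSemigroup = record
        { isMagma = record
          { isEquivalence = record
            { refl  = λ i j → refl
            ; sym   = λ p i j → ≡.sym (p i j)
            ; trans = λ p q i j → ≡.trans (p i j) (q i j)
            }
          ; ∙-cong = λ p q → *ℤ-cong p q
          }
        ; assoc = λ A B C → assocᴹ (matrix A) (matrix B) (matrix C)
        }
      ; identity = (λ A → identityˡᴹ (matrix A)) , (λ A → identityʳᴹ (matrix A))
      }
    ; inverse = (λ A → ᵀ-inverseʳ (ᵀ-monomial (isMonomial A))) , (λ A → ᵀ-inverseʳ (isMonomial A))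
    ; ⁻¹-cong = λ p i j → p j i
    }
  }

SP : (m : ℕ) → .{{NonZero m}} → SignedGroup 0ℓ 0ℓ
SP m = record
  { group       = monomialGroup m
  ; -1#         = mkMonomial (-ℤ 1ℤᴹ) (-ᴹ-monomial 1ᴹ-monomial)
  ; -1#-central = λ (mkMonomial A _) i j → begin
      ((-ℤ 1ℤᴹ) *ℤ A) i j     ≡⟨ neg-*ˡ 1ℤᴹ A i j ⟩
      ℤ.- (1ℤᴹ *ℤ A) i j      ≡⟨ cong ℤ.-_ (≡.trans (identityˡᴹ A i j) (≡.sym (identityʳᴹ A i j))) ⟩
      ℤ.- (A *ℤ 1ℤᴹ) i j      ≡⟨ neg-*ʳ A 1ℤᴹ i j ⟨
      (A *ℤ (-ℤ 1ℤᴹ)) i j     ∎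
  ; -1#-square  = λ i j → begin
      ((-ℤ 1ℤᴹ) *ℤ (-ℤ 1ℤᴹ)) i j  ≡⟨ neg-*ˡ 1ℤᴹ (-ℤ 1ℤᴹ) i j ⟩
      ℤ.- (1ℤᴹ *ℤ (-ℤ 1ℤᴹ)) i j   ≡⟨ cong ℤ.-_ (identityˡᴹ (-ℤ 1ℤᴹ) i j) ⟩
      ℤ.- (ℤ.- 1ℤᴹ i j)           ≡⟨ ℤ.neg-involutive (1ℤᴹ i j) ⟩
      1ℤᴹ i j                     ∎
  ; -1#≉ε       = -1ᴹ≉1ᴹ m
  }
  where
  -1ᴹ≉1ᴹ : ∀ m → .{{NonZero m}} → ¬ (-ℤ 1ℤᴹ {m} ≈ℤ 1ℤᴹ)
  -1ᴹ≉1ᴹ (suc _) eq with eq zero zero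
  ... | ()

Remrep : SignedGroup c ℓ → (m : ℕ) → .{{NonZero m}} → Set (c ⊔ ℓ)
Remrep S m = SignedGroupHomomorphism S (SP m)

record HadamardMatrix (m : ℕ) : Set where
  field
    H          : Matrix ℤ m
    entries    : ∀ i j → H i j ≡ 1ℤ ⊎ H i j ≡ -1ℤ
    orthogonal : (H *ℤ (H ᵀ)) ≈ℤ ((+ m) •ℤ 1ℤᴹ)

-- The signed group ring ℝ[S] with k commuting indeterminates adjoined.
module SignedGroupRing (S : SignedGroup c ℓ) (k : ℕ) where
  private
    module S = SignedGroup S
    module ℝ = CommutativeRing ℝ

  -- The term (r , α , s) stands for r x₁^α₁ ⋯ xₖ^αₖ s, a list for the sum of its
  -- terms.  The last component of a term is any element of S, not only a chosen
  -- coset representative modulo -1; the relation `sign` below identifies the two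
  -- ways of writing a term.
  Term : Set c
  Term = ℝ.Carrier × Vec ℕ k × S.Carrier

  FormalSum : Set c
  FormalSum = List Term

  infix 4 _≈_
  data _≈_ : FormalSum → FormalSum → Set (c ⊔ ℓ) where
    ≈-refl  : ∀ {p} → p ≈ p
    ≈-sym   : ∀ {p q} → p ≈ q → q ≈ p
    ≈-trans : ∀ {p q r} → p ≈ q → q ≈ r → p ≈ r
    ++-cong : ∀ {p p′ q q′} → p ≈ p′ → q ≈ q′ → p ++ q ≈ p′ ++ q′
    ++-comm : ∀ p q → p ++ q ≈ q ++ p
    term    : ∀ {r r′ α s s′} → r ℝ.≈ r′ → s S.≈ s′ → [ r , α , s ] ≈ [ r′ , α , s′ ]
    collect : ∀ r r′ α s → [ r , α , s ] ++ [ r′ , α , s ] ≈ [ r ℝ.+ r′ , α , s ]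
    cancel  : ∀ α s → [ ℝ.0# , α , s ] ≈ []
    sign    : ∀ r α s → [ ℝ.- r , α , s ] ≈ [ r , α , S.-1# S.∙ s ]

  _·_ : Term → Term → Term
  (r , α , s) · (r′ , β , t) = r ℝ.* r′ , zipWith ℕ._+_ α β , s S.∙ t

  1ₘ : Vec ℕ k
  1ₘ = replicate k 0

  rawRing : RawRing c (c ⊔ ℓ)
  rawRing = record
    { Carrier = FormalSum
    ; _≈_     = _≈_
    ; _+_     = _++_
    ; _*_     = cartesianProductWith _·_
    ; -_      = map λ (r , α , s) → ℝ.- r , α , s
    ; 0#      = []
    ; 1#      = [ ℝ.1# , 1ₘ , S.ε ]
    }

  conj : FormalSum → FormalSum
  conj = map λ (r , α , s) → r , α , s S.⁻¹

  ⟨_⟩ : S.Carrier → FormalSum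
  ⟨ s ⟩ = [ ℝ.1# , 1ₘ , s ]

  var : Fin k → FormalSum
  var l = [ ℝ.1# , 1ₘ [ l ]≔ 1 , S.ε ]

  _⋆ : Matrix FormalSum n → Matrix FormalSum n
  (A ⋆) i j = conj (A j i)

record SOD (S : SignedGroup c ℓ) (n k : ℕ) (u : Fin k → ℕ) : Set (c ⊔ ℓ) where
  open SignedGroupRing S k
  open RawRing rawRing using (_+_; _*_; 0#; +-rawMonoid)
  open RawMonoidDefs +-rawMonoid using (sum) renaming (_×_ to _×ₙ_)
  open MatrixOperations rawRing
  field
    X          : Matrix FormalSum n
    entries    : ∀ i j → X i j ≈ 0# ⊎ ∃₂ λ ε l → X i j ≈ ⟨ ε ⟩ * var l
    orthogonal : (X *ᴹ (X ⋆)) ≈ᴹ (sum (λ l → u l ×ₙ (var l * var l)) • 1ᴹ)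

OD : (n k : ℕ) → (Fin k → ℕ) → Set
OD = SOD trivialSignedGroup

{-# OPTIONS --safe #-}

module Submission where

-- Replace each entry ε x of the design X by the block x π(ε) H, where H is the
-- Hadamard matrix; as π(ε) is monomial, all entries of the block are ±x.  Entries
-- ε x and δ y contribute x y π(ε) HHᵀ π(δ)ᵀ = m x y π(ε δ⁻¹) to a block of the Gram
-- matrix of the result, so that Gram matrix is m π(XX*).

open import Algebra.Bundles using (CommutativeMonoid; CommutativeRing; RawRing; Ring)
open import Algebra.Morphism.Structures using (IsGroupHomomorphism)
import Algebra.Properties.CommutativeMonoid.Mult as CommutativeMonoidMult
import Algebra.Properties.CommutativeMonoid.Sum as CommutativeMonoidSum
import Algebra.Properties.CommutativeSemigroup as CommutativeSemigroupProperties
import Algebra.Properties.Ring as RingProperties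
import Algebra.Properties.Semiring.Mult as SemiringMult
import Algebra.Properties.Semiring.Sum as SemiringSum
open import Data.Empty using (⊥-elim)
open import Data.Fin.Base using (Fin; zero; suc; punchIn; combine; quotient; remainder; _↑ˡ_; _↑ʳ_)
open import Data.Fin.Properties
  using (_≟_; punchInᵢ≢i; combine-injectiveˡ; combine-injectiveʳ; combine-remQuot; remQuot-combine)
open import Data.Integer.Base as ℤ using (ℤ; 0ℤ; 1ℤ; -1ℤ; +_; -[1+_]; _⊖_)
import Data.Integer.Properties as ℤ
open import Data.List.Base using (List; []; _∷_; [_]; _++_; map; cartesianProductWith)
import Data.List.Properties as List
open import Data.Nat.Base as ℕ using (ℕ; zero; suc; NonZero)
import Data.Nat.Properties as ℕ
open import Data.Product using (_,_; proj₁; proj₂; ∃; ∃₂)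
import Data.Sign.Base as Sign
import Data.Sign.Properties as Sign
open import Data.Sum.Base as Sum using (_⊎_; inj₁; inj₂)
open import Data.Vec.Functional using (removeAt)
open import Defs
open import Function.Base using (_∘_)
open import Level using (Level; _⊔_)
open import Relation.Binary.PropositionalEquality as ≡ using (_≡_; _≢_; cong; cong₂)
import Relation.Binary.Reasoning.Setoid as SetoidReasoning
open import Relation.Nullary using (yes; no)
open import Relation.Nullary.Decidable using (dec-true; dec-false)

private
  variable
    c c′ ℓ ℓ′ : Level
    A B C D E : Set ℓ
    m n : ℕ

-- Lists of pairwise products

map-cartesianProductWith : (g : C → D) (f : A → B → C) (xs : List A) (ys : List B) →
  map g (cartesianProductWith f xs ys) ≡ cartesianProductWith (λ x y → g (f x y)) xs ys
map-cartesianProductWith g f []       ys = ≡.refl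
map-cartesianProductWith g f (x ∷ xs) ys =
  ≡.trans (List.map-++ g (map (f x) ys) _)
    (cong₂ _++_ (≡.sym (List.map-∘ ys)) (map-cartesianProductWith g f xs ys))

cartesianProductWith-map : (f : C → D → E) (g : A → C) (h : B → D) (xs : List A) (ys : List B) →
  cartesianProductWith f (map g xs) (map h ys) ≡ cartesianProductWith (λ x y → f (g x) (h y)) xs ys
cartesianProductWith-map f g h []       ys = ≡.refl
cartesianProductWith-map f g h (x ∷ xs) ys =
  cong₂ _++_ (≡.sym (List.map-∘ ys)) (cartesianProductWith-map f g h xs ys)

-- Finite sums in a commutative monoid

module SumProperties (M : CommutativeMonoid c ℓ) where
  open CommutativeMonoid M
    renaming (_∙_ to _+_; ε to 0#; ∙-congˡ to +-congˡ; assoc to +-assoc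
             ; identityˡ to +-identityˡ; identityʳ to +-identityʳ)
  open CommutativeMonoidSum M
  open SetoidReasoning setoid

  sum-single : (f : Fin n → Carrier) (k : Fin n) → (∀ l → k ≢ l → f l ≈ 0#) → sum f ≈ f k
  sum-single {suc n} f k vanish = begin
    sum f                          ≈⟨ sum-remove {i = k} f ⟩
    f k + sum (removeAt f k)       ≈⟨ +-congˡ (sum-cong-≋ λ l → vanish (punchIn k l) (punchInᵢ≢i k l ∘ ≡.sym)) ⟩
    f k + sum {n} (λ _ → 0#)       ≈⟨ +-congˡ (sum-replicate-zero n) ⟩
    f k + 0#                       ≈⟨ +-identityʳ (f k) ⟩
    f k                            ∎

  sum-splitAt : ∀ m (f : Fin (m ℕ.+ n) → Carrier) →
    sum f ≈ sum (λ i → f (i ↑ˡ n)) + sum (λ j → f (m ↑ʳ j))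
  sum-splitAt zero    f = sym (+-identityˡ (sum f))
  sum-splitAt (suc m) f = trans (+-congˡ (sum-splitAt m (f ∘ suc))) (sym (+-assoc (f zero) _ _))

  sum-combine : ∀ m n (f : Fin (m ℕ.* n) → Carrier) →
    sum f ≈ sum λ (i : Fin m) → sum λ (j : Fin n) → f (combine i j)
  sum-combine zero    n f = refl
  sum-combine (suc m) n f = trans (sum-splitAt n f) (+-congˡ (sum-combine m n λ x → f (n ↑ʳ x)))

-- The canonical ring homomorphism from the integers

module IntegerEmbedding (R : Ring c ℓ) where
  open Ring R hiding (zero)
  open RingProperties R
  open SemiringMult semiring
  open SetoidReasoning setoid
  open CommutativeMonoidSum +-commutativeMonoid using (sum)
  open CommutativeMonoidSum (CommutativeRing.+-commutativeMonoid ℤ.+-*-commutativeRing)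
    using () renaming (sum to sumℤ)

  ι : ℤ → Carrier
  ι (+ n)    = n × 1#
  ι -[1+ n ] = - (suc n × 1#)

  -- Integer addition with opposite signs is computed by `_⊖_`, so this supplies the two mixed cases
  -- of `ι-+`. Induction removes one successor from each argument.
  ι-⊖ : ∀ m n → ι (m ⊖ n) ≈ m × 1# - n × 1#
  ι-⊖ m       zero    = sym (trans (+-congˡ -0#≈0#) (+-identityʳ _))
  ι-⊖ zero    (suc n) = sym (+-identityˡ _)
  ι-⊖ (suc m) (suc n) = begin
    ι (suc m ⊖ suc n)                      ≡⟨ cong ι (ℤ.[1+m]⊖[1+n]≡m⊖n m n) ⟩
    ι (m ⊖ n)                              ≈⟨ ι-⊖ m n ⟩
    -- `M` is expanded to `(1# + M) - 1#`, which restores the two copies of `1#` lost with the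
    -- successors.
    M - N                                  ≈⟨ +-congʳ (xyx⁻¹≈y 1# M) ⟨
    ((1# + M) - 1#) - N                    ≈⟨ +-assoc (1# + M) (- 1#) (- N) ⟩
    (1# + M) + (- 1# - N)                  ≈⟨ +-congˡ (-‿+-comm 1# N) ⟩
    (1# + M) - (1# + N)                    ∎
    where
    M = m × 1#
    N = n × 1#

  ι-+ : ∀ x y → ι (x ℤ.+ y) ≈ ι x + ι y
  ι-+ (+ m)    (+ n)    = ×-homo-+ 1# m n
  ι-+ (+ m)    -[1+ n ] = ι-⊖ m (suc n)
  ι-+ -[1+ m ] (+ n)    = trans (ι-⊖ n (suc m)) (+-comm _ _)
  ι-+ -[1+ m ] -[1+ n ] = begin
    - (suc (suc (m ℕ.+ n)) × 1#)           ≡⟨ cong (λ k → - (k × 1#)) (ℕ.+-suc (suc m) n) ⟨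
    - ((suc m ℕ.+ suc n) × 1#)             ≈⟨ -‿cong (×-homo-+ 1# (suc m) (suc n)) ⟩
    - (suc m × 1# + suc n × 1#)            ≈⟨ -‿+-comm _ _ ⟨
    - (suc m × 1#) - suc n × 1#            ∎

  ι-neg : ∀ x → ι (ℤ.- x) ≈ - ι x
  ι-neg (+ zero)  = sym -0#≈0#
  ι-neg (+ suc n) = refl
  ι-neg -[1+ n ]  = sym (-‿involutive _)

  ι-*-+ : ∀ m n → ι (+ m ℤ.* + n) ≈ ι (+ m) * ι (+ n)
  ι-*-+ m n = trans (reflexive (cong ι (≡.sym (ℤ.pos-* m n)))) (×1-homo-* m n)

  -- Since `-[1+ n ]` is by computation the negation of `+ suc n`, the sign of the right factor can
  -- be pulled out, leaving natural numbers. `ι-*` then treats the left factor in the same way.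
  ι-*-posˡ : ∀ m y → ι (+ m ℤ.* y) ≈ ι (+ m) * ι y
  ι-*-posˡ m (+ n)    = ι-*-+ m n
  ι-*-posˡ m -[1+ n ] = begin
    ι (+ m ℤ.* ℤ.- (+ suc n))              ≡⟨ cong ι (ℤ.neg-distribʳ-* (+ m) (+ suc n)) ⟨
    ι (ℤ.- (+ m ℤ.* + suc n))              ≈⟨ ι-neg (+ m ℤ.* + suc n) ⟩
    - ι (+ m ℤ.* + suc n)                  ≈⟨ -‿cong (ι-*-+ m (suc n)) ⟩
    - (ι (+ m) * ι (+ suc n))              ≈⟨ -‿distribʳ-* _ _ ⟩
    ι (+ m) * ι -[1+ n ]                   ∎

  ι-* : ∀ x y → ι (x ℤ.* y) ≈ ι x * ι y
  ι-* (+ m)    y = ι-*-posˡ m y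
  ι-* -[1+ m ] y = begin
    ι (ℤ.- (+ suc m) ℤ.* y)                ≡⟨ cong ι (ℤ.neg-distribˡ-* (+ suc m) y) ⟨
    ι (ℤ.- (+ suc m ℤ.* y))                ≈⟨ ι-neg (+ suc m ℤ.* y) ⟩
    - ι (+ suc m ℤ.* y)                    ≈⟨ -‿cong (ι-*-posˡ (suc m) y) ⟩
    - (ι (+ suc m) * ι y)                  ≈⟨ -‿distribˡ-* _ _ ⟩
    ι -[1+ m ] * ι y                       ∎

  ι-sum : (f : Fin n → ℤ) → ι (sumℤ f) ≈ sum (λ i → ι (f i))
  ι-sum {zero}  f = refl
  ι-sum {suc n} f = trans (ι-+ (f zero) _) (+-congˡ (ι-sum (f ∘ suc)))

-- Matrices over a commutative ring

module MatrixProperties (R : CommutativeRing c ℓ) where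
  open CommutativeRing R hiding (zero)
  open MatrixOperations rawRing
  open RingProperties ring using (-‿distribˡ-*; -0#≈0#; -‿+-comm)
  open SemiringSum semiring
  open SumProperties +-commutativeMonoid
  open SetoidReasoning setoid

  private
    variable
      X Y Z : Matrix Carrier n

  1ᴹ-diag : (i : Fin n) → 1ᴹ i i ≡ 1#
  1ᴹ-diag i rewrite dec-true (i ≟ i) ≡.refl = ≡.refl

  1ᴹ-off : {i j : Fin n} → i ≢ j → 1ᴹ i j ≡ 0#
  1ᴹ-off {i = i} {j} i≢j rewrite dec-false (i ≟ j) i≢j = ≡.refl

  *ᴹ-congˡ : (X : Matrix Carrier n) → Y ≈ᴹ Z → X *ᴹ Y ≈ᴹ X *ᴹ Z
  *ᴹ-congˡ X Y≈Z i j = sum-cong-≋ λ l → *-congˡ (Y≈Z l j)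

  *ᴹ-congʳ : (Z : Matrix Carrier n) → X ≈ᴹ Y → X *ᴹ Z ≈ᴹ Y *ᴹ Z
  *ᴹ-congʳ Z X≈Y i j = sum-cong-≋ λ l → *-congʳ (X≈Y i l)

  *ᴹ-assoc : (X Y Z : Matrix Carrier n) → (X *ᴹ Y) *ᴹ Z ≈ᴹ X *ᴹ (Y *ᴹ Z)
  *ᴹ-assoc {n} X Y Z i j = begin
    ∑[ l < n ] (∑[ k < n ] (X i k * Y k l) * Z l j)
      ≈⟨ sum-cong-≋ (λ l → *-distribʳ-sum (Z l j) (λ k → X i k * Y k l)) ⟩
    ∑[ l < n ] ∑[ k < n ] (X i k * Y k l * Z l j)
      ≈⟨ ∑-comm (λ l k → X i k * Y k l * Z l j) ⟩
    ∑[ k < n ] ∑[ l < n ] (X i k * Y k l * Z l j)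
      ≈⟨ sum-cong-≋ (λ k → sum-cong-≋ λ l → *-assoc (X i k) (Y k l) (Z l j)) ⟩
    ∑[ k < n ] ∑[ l < n ] (X i k * (Y k l * Z l j))
      ≈⟨ sum-cong-≋ (λ k → *-distribˡ-sum (X i k) (λ l → Y k l * Z l j)) ⟨
    ∑[ k < n ] (X i k * ∑[ l < n ] (Y k l * Z l j)) ∎

  *ᴹ-identityˡ : (X : Matrix Carrier n) → 1ᴹ *ᴹ X ≈ᴹ X
  *ᴹ-identityˡ X i j = begin
    sum (λ l → 1ᴹ i l * X l j)
      ≈⟨ sum-single _ i (λ l i≢l → trans (*-congʳ (reflexive (1ᴹ-off i≢l))) (zeroˡ _)) ⟩
    1ᴹ i i * X i j    ≈⟨ *-congʳ (reflexive (1ᴹ-diag i)) ⟩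
    1# * X i j        ≈⟨ *-identityˡ (X i j) ⟩
    X i j             ∎

  ᵀ-*ᴹ : (X Y : Matrix Carrier n) → (X *ᴹ Y) ᵀ ≈ᴹ (Y ᵀ) *ᴹ (X ᵀ)
  ᵀ-*ᴹ X Y i j = sum-cong-≋ λ l → *-comm (X j l) (Y l i)

  •-*ᴹˡ : ∀ x (X Y : Matrix Carrier n) → (x • X) *ᴹ Y ≈ᴹ x • (X *ᴹ Y)
  •-*ᴹˡ x X Y i j = begin
    sum (λ l → x * X i l * Y l j)      ≈⟨ sum-cong-≋ (λ l → *-assoc x (X i l) (Y l j)) ⟩
    sum (λ l → x * (X i l * Y l j))    ≈⟨ *-distribˡ-sum x (λ l → X i l * Y l j) ⟨
    x * (X *ᴹ Y) i j                   ∎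

  •-*ᴹʳ : ∀ x (X Y : Matrix Carrier n) → X *ᴹ (x • Y) ≈ᴹ x • (X *ᴹ Y)
  •-*ᴹʳ x X Y i j = begin
    sum (λ l → X i l * (x * Y l j))    ≈⟨ sum-cong-≋ (λ l → *-congˡ (*-comm x (Y l j))) ⟩
    sum (λ l → X i l * (Y l j * x))    ≈⟨ sum-cong-≋ (λ l → *-assoc (X i l) (Y l j) x) ⟨
    sum (λ l → X i l * Y l j * x)      ≈⟨ *-distribʳ-sum x (λ l → X i l * Y l j) ⟨
    (X *ᴹ Y) i j * x                   ≈⟨ *-comm _ x ⟩
    x * (X *ᴹ Y) i j                   ∎

  -ᴹ-*ᴹˡ : (X Y : Matrix Carrier n) → (-ᴹ X) *ᴹ Y ≈ᴹ -ᴹ (X *ᴹ Y)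
  -ᴹ-*ᴹˡ {n} X Y i j = trans (sum-cong-≋ λ l → sym (-‿distribˡ-* (X i l) (Y l j))) (sum-neg λ l → X i l * Y l j)
    where
    sum-neg : ∀ {n} (f : Fin n → Carrier) → sum (λ l → - f l) ≈ - sum f
    sum-neg {zero}  f = sym -0#≈0#
    sum-neg {suc n} f = trans (+-congˡ (sum-neg (f ∘ suc))) (-‿+-comm _ _)

  -- Transposing reverses the second product, so `H` and `H ᵀ` meet in the middle; their product is
  -- a scalar matrix, and the scalar can be pulled to the front. It is applied over ℤ to the
  -- Hadamard matrix, with `x = + m`.
  gram : ∀ {x} {H : Matrix Carrier n} → H *ᴹ (H ᵀ) ≈ᴹ x • 1ᴹ → (X Y : Matrix Carrier n) →
         (X *ᴹ H) *ᴹ ((Y *ᴹ H) ᵀ) ≈ᴹ x • (X *ᴹ (Y ᵀ))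
  gram {x = x} {H} orth X Y i j = begin
    ((X *ᴹ H) *ᴹ ((Y *ᴹ H) ᵀ)) i j            ≈⟨ *ᴹ-congˡ (X *ᴹ H) (ᵀ-*ᴹ Y H) i j ⟩
    ((X *ᴹ H) *ᴹ ((H ᵀ) *ᴹ (Y ᵀ))) i j        ≈⟨ *ᴹ-assoc X H ((H ᵀ) *ᴹ (Y ᵀ)) i j ⟩
    (X *ᴹ (H *ᴹ ((H ᵀ) *ᴹ (Y ᵀ)))) i j        ≈⟨ *ᴹ-congˡ {Z = H *ᴹ ((H ᵀ) *ᴹ (Y ᵀ))} X (*ᴹ-assoc H (H ᵀ) (Y ᵀ)) i j ⟨
    (X *ᴹ ((H *ᴹ (H ᵀ)) *ᴹ (Y ᵀ))) i j        ≈⟨ *ᴹ-congˡ X (*ᴹ-congʳ {X = H *ᴹ (H ᵀ)} {Y = x • 1ᴹ} (Y ᵀ) orth) i j ⟩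
    (X *ᴹ ((x • 1ᴹ) *ᴹ (Y ᵀ))) i j            ≈⟨ *ᴹ-congˡ X (•-*ᴹˡ x 1ᴹ (Y ᵀ)) i j ⟩
    (X *ᴹ (x • (1ᴹ *ᴹ (Y ᵀ)))) i j            ≈⟨ •-*ᴹʳ x X (1ᴹ *ᴹ (Y ᵀ)) i j ⟩
    x * (X *ᴹ (1ᴹ *ᴹ (Y ᵀ))) i j              ≈⟨ *-congˡ (*ᴹ-congˡ X (*ᴹ-identityˡ (Y ᵀ)) i j) ⟩
    x * (X *ᴹ (Y ᵀ)) i j                      ∎

-- The additive structure of the signed group ring

module SignedGroupRingProperties (S : SignedGroup c ℓ) (k : ℕ) where
  private
    module S = SignedGroup S
    module ℝ = CommutativeRing ℝ
  open SignedGroupRing S k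
  open SemiringMult ℝ.semiring using () renaming (_×_ to _×ℝ_)
  open CommutativeMonoidSum ℝ.+-commutativeMonoid using () renaming (sum to sumℝ)

  ≡⇒≈ : ∀ {p q} → p ≡ q → p ≈ q
  ≡⇒≈ ≡.refl = ≈-refl

  +-commutativeMonoid : CommutativeMonoid _ _
  +-commutativeMonoid = record
    { Carrier = FormalSum
    ; _≈_ = _≈_
    ; _∙_ = _++_
    ; ε   = []
    ; isCommutativeMonoid = record
      { isMonoid = record
        { isSemigroup = record
          { isMagma = record
            { isEquivalence = record { refl = ≈-refl ; sym = ≈-sym ; trans = ≈-trans }
            ; ∙-cong = ++-cong
            }
          ; assoc = λ p q r → ≡⇒≈ (List.++-assoc p q r)
          }
        ; identity = (λ p → ≈-refl) , (λ p → ≡⇒≈ (List.++-identityʳ p))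
        }
      ; comm = ++-comm
      }
    }

  open CommutativeMonoid +-commutativeMonoid public using (setoid)
  open CommutativeMonoidSum +-commutativeMonoid public
  open CommutativeMonoidMult +-commutativeMonoid public using (_×_; ×-congʳ; ×-assocˡ)
  open SetoidReasoning setoid

  sum-zero : {f : Fin n → FormalSum} → (∀ i → f i ≈ []) → sum f ≈ []
  sum-zero {n} f≈0 = ≈-trans (sum-cong-≋ f≈0) (sum-replicate-zero n)

  ×-zeroʳ : ∀ n {p} → p ≈ [] → n × p ≈ []
  ×-zeroʳ zero    p≈0 = ≈-refl
  ×-zeroʳ (suc n) p≈0 = ++-cong p≈0 (×-zeroʳ n p≈0)

  ×-term : ∀ n r {α s} → n × [ r , α , s ] ≈ [ n ×ℝ r , α , s ]
  ×-term zero    r = ≈-sym (cancel _ _)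
  ×-term (suc n) r = ≈-trans (++-cong ≈-refl (×-term n r)) (collect _ _ _ _)

  sum-term : (f : Fin n → ℝ.Carrier) → ∀ {α s} → sum (λ i → [ f i , α , s ]) ≈ [ sumℝ f , α , s ]
  sum-term {zero}  f = ≈-sym (cancel _ _)
  sum-term {suc n} f = ≈-trans (++-cong ≈-refl (sum-term (f ∘ suc))) (collect _ _ _ _)

  sum-map : (f : Fin n → A → Term) (g : A → Term) → (∀ x → sum (λ i → [ f i x ]) ≈ [ g x ]) →
            ∀ xs → sum (λ i → map (f i) xs) ≈ map g xs
  sum-map {n = n} f g h []       = sum-zero {n} λ _ → ≈-refl
  sum-map         f g h (x ∷ xs) = begin
    sum (λ i → [ f i x ] ++ map (f i) xs)
      ≈⟨ ∑-distrib-+ (λ i → [ f i x ]) (λ i → map (f i) xs) ⟩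
    sum (λ i → [ f i x ]) ++ sum (λ i → map (f i) xs)
      ≈⟨ ++-cong (h x) (sum-map f g h xs) ⟩
    map g (x ∷ xs) ∎

  -- The sum over `i` is exchanged with the sum over pairs from the two lists, so an identity
  -- between products of lists needs checking only for one pair of terms. `sum-map` does this for a
  -- single list and serves here for each row of pairs.
  sum-cartesianProductWith : (f : Fin n → A → B → Term) (g : A → B → Term) →
    (∀ x y → sum (λ i → [ f i x y ]) ≈ [ g x y ]) →
    ∀ xs ys → sum (λ i → cartesianProductWith (f i) xs ys) ≈ cartesianProductWith g xs ys
  sum-cartesianProductWith {n = n} f g h []       ys = sum-zero {n} λ _ → ≈-refl
  sum-cartesianProductWith         f g h (x ∷ xs) ys = begin
    sum (λ i → map (f i x) ys ++ cartesianProductWith (f i) xs ys)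
      ≈⟨ ∑-distrib-+ (λ i → map (f i x) ys) (λ i → cartesianProductWith (f i) xs ys) ⟩
    sum (λ i → map (f i x) ys) ++ sum (λ i → cartesianProductWith (f i) xs ys)
      ≈⟨ ++-cong (sum-map (λ i → f i x) (g x) (h x) ys) (sum-cartesianProductWith f g h xs ys) ⟩
    cartesianProductWith g (x ∷ xs) ys ∎

  open MatrixOperations rawRing using (1ᴹ)

  1ᴹ-diag : (i : Fin n) → 1ᴹ i i ≡ RawRing.1# rawRing
  1ᴹ-diag i rewrite dec-true (i ≟ i) ≡.refl = ≡.refl

  1ᴹ-off : {i j : Fin n} → i ≢ j → 1ᴹ i j ≡ []
  1ᴹ-off {i = i} {j} i≢j rewrite dec-false (i ≟ j) i≢j = ≡.refl

-- Additive maps between signed group rings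

module Additive {S : SignedGroup c ℓ} {T : SignedGroup c′ ℓ′} {k : ℕ}
  (G : SignedGroupRing.FormalSum S k → SignedGroupRing.FormalSum T k)
  (G-[] : G [] ≡ []) (G-++ : ∀ p q → G (p ++ q) ≡ G p ++ G q) where
  private
    module S = SignedGroupRingProperties S k
    module T = SignedGroupRingProperties T k

  map-× : ∀ n p → G (n S.× p) ≡ n T.× G p
  map-× zero    p = G-[]
  map-× (suc n) p = ≡.trans (G-++ p _) (cong (G p ++_) (map-× n p))

  map-sum : (f : Fin n → SignedGroupRing.FormalSum S k) → G (S.sum f) ≡ T.sum (λ i → G (f i))
  map-sum {zero}  f = G-[]
  map-sum {suc n} f = ≡.trans (G-++ (f zero) _) (cong (G (f zero) ++_) (map-sum (f ∘ suc)))

  -- Addition is concatenation, which `G` respects up to `≡`; hence `G` can be moved through the sum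
  -- without being known to respect `≈`. It will be a right multiplication by `1#`, possibly
  -- followed by a linear extension `Φ f`.
  map-combination : (u : Fin n → ℕ) (f : Fin n → SignedGroupRing.FormalSum S k) →
    G (S.sum (λ i → u i S.× f i)) ≡ T.sum (λ i → u i T.× G (f i))
  map-combination u f = ≡.trans (map-sum λ i → u i S.× f i) (T.sum-cong-≗ λ i → map-× (u i) (f i))

-- Linear extension of odd functions on the signed group

record IsOdd (S : SignedGroup c ℓ) (f : SignedGroup.Carrier S → ℤ) : Set (c ⊔ ℓ) where
  open SignedGroup S
  field
    f-cong : ∀ {s t} → s ≈ t → f s ≡ f t
    f-odd  : ∀ s → f (-1# ∙ s) ≡ ℤ.- f s

module Realization (S : SignedGroup c ℓ) (k : ℕ) where
  private
    module S = SignedGroup S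
    module ℝ = CommutativeRing ℝ
    module R where
      open SignedGroupRing S k public
      open SignedGroupRingProperties S k public
    module T where
      open SignedGroupRing trivialSignedGroup k public
      open SignedGroupRingProperties trivialSignedGroup k public
  open IntegerEmbedding ℝ.ring
  open RingProperties ℝ.ring using (-‿distribˡ-*; -‿distribʳ-*)
  open CommutativeMonoidSum (CommutativeRing.+-commutativeMonoid ℤ.+-*-commutativeRing)
    using () renaming (sum to sumℤ)
  open SemiringSum ℝ.semiring using (*-distribˡ-sum) renaming (sum to sumℝ; sum-cong-≋ to sumℝ-cong)
  open CommutativeSemigroupProperties ℝ.*-commutativeSemigroup using (interchange)

  -- An odd f : S → ℤ extends to a linear map from ℝ[S] to the polynomials; only
  -- the sign + occurs in its values, the integer f s going into the coefficient.
  φ : (S.Carrier → ℤ) → R.Term → T.Term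
  φ f (r , α , s) = r ℝ.* ι (f s) , α , Sign.+

  Φ : (S.Carrier → ℤ) → R.FormalSum → T.FormalSum
  Φ f = map (φ f)

  -- Induction on the derivation of `p ≈ q`. Oddness is exactly what the relation `sign` demands:
  -- moving the scalar -1 into the group element must change the sign of the integer factor. All
  -- other relations are preserved by linearity in the coefficient and `f-cong`.
  Φ-cong : ∀ {f} → IsOdd S f → ∀ {p q} → p R.≈ q → Φ f p T.≈ Φ f q
  Φ-cong {f} odd = go
    where
    open IsOdd odd
    go : ∀ {p q} → p R.≈ q → Φ f p T.≈ Φ f q
    go R.≈-refl        = T.≈-refl
    go (R.≈-sym p)     = T.≈-sym (go p)
    go (R.≈-trans p q) = T.≈-trans (go p) (go q)
    go (R.++-cong {p} {p′} {q} {q′} x y)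
      rewrite List.map-++ (φ f) p q | List.map-++ (φ f) p′ q′ = T.++-cong (go x) (go y)
    go (R.++-comm p q)
      rewrite List.map-++ (φ f) p q | List.map-++ (φ f) q p = T.++-comm (Φ f p) (Φ f q)
    go (R.term r s)    = T.term (ℝ.*-cong r (ℝ.reflexive (cong ι (f-cong s)))) ≡.refl
    go (R.collect r r′ α s) =
      T.≈-trans (T.collect _ _ _ _) (T.term (ℝ.sym (ℝ.distribʳ (ι (f s)) r r′)) ≡.refl)
    go (R.cancel α s)  = T.≈-trans (T.term (ℝ.zeroˡ _) ≡.refl) (T.cancel _ _)
    go (R.sign r α s)  = T.term (begin
      ℝ.- r ℝ.* ι (f s)              ≈⟨ -‿distribˡ-* r _ ⟨
      ℝ.- (r ℝ.* ι (f s))            ≈⟨ -‿distribʳ-* r _ ⟩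
      r ℝ.* ℝ.- ι (f s)              ≈⟨ ℝ.*-congˡ (ι-neg (f s)) ⟨
      r ℝ.* ι (ℤ.- f s)              ≡⟨ cong (λ z → r ℝ.* ι z) (f-odd s) ⟨
      r ℝ.* ι (f (S.-1# S.∙ s))      ∎) ≡.refl
      where open SetoidReasoning ℝ.setoid

  -- As `ι` is a ring homomorphism, an integer identity for an entry of a matrix product carries
  -- over to real coefficients once `r` and `r′` are factored out.
  coefficients : (x y : Fin n → ℤ) {z : ℤ} → sumℤ (λ b → x b ℤ.* y b) ≡ z → ∀ r r′ →
    sumℝ (λ b → r ℝ.* ι (x b) ℝ.* (r′ ℝ.* ι (y b))) ℝ.≈ r ℝ.* r′ ℝ.* ι z
  coefficients x y {z} eq r r′ = begin
    sumℝ (λ b → r ℝ.* ι (x b) ℝ.* (r′ ℝ.* ι (y b)))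
      ≈⟨ sumℝ-cong (λ b → interchange r (ι (x b)) r′ (ι (y b))) ⟩
    sumℝ (λ b → r ℝ.* r′ ℝ.* (ι (x b) ℝ.* ι (y b)))
      ≈⟨ *-distribˡ-sum (r ℝ.* r′) (λ b → ι (x b) ℝ.* ι (y b)) ⟨
    r ℝ.* r′ ℝ.* sumℝ (λ b → ι (x b) ℝ.* ι (y b))
      ≈⟨ ℝ.*-congˡ (sumℝ-cong λ b → ι-* (x b) (y b)) ⟨
    r ℝ.* r′ ℝ.* sumℝ (λ b → ι (x b ℤ.* y b))
      ≈⟨ ℝ.*-congˡ (ι-sum (λ b → x b ℤ.* y b)) ⟨
    r ℝ.* r′ ℝ.* ι (sumℤ (λ b → x b ℤ.* y b))
      ≡⟨ cong (λ w → r ℝ.* r′ ℝ.* ι w) eq ⟩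
    r ℝ.* r′ ℝ.* ι z ∎
    where open SetoidReasoning ℝ.setoid

  -- This turns an integer identity on group elements into one on formal sums. Both sides are
  -- additive in `p` and in `q`, so it suffices to compare them on two terms; there the hypothesis
  -- matches the group element `s S.∙ t S.⁻¹` that conjugation produces in the product.
  sum-Φ* : (f g : Fin n → S.Carrier → ℤ) (F : S.Carrier → ℤ) →
    (∀ s t → sumℤ (λ b → f b s ℤ.* g b t) ≡ F (s S.∙ t S.⁻¹)) → ∀ p q →
    T.sum (λ b → cartesianProductWith T._·_ (Φ (f b) p) (T.conj (Φ (g b) q)))
      T.≈ Φ F (cartesianProductWith R._·_ p (R.conj q))
  sum-Φ* {n} f g F h p q = begin
    T.sum (λ b → cartesianProductWith T._·_ (Φ (f b) p) (T.conj (Φ (g b) q)))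
      -- The values of `Φ` carry only the sign `Sign.+`, which is its own inverse by computation, so
      -- `T.conj` disappears here.
      ≡⟨ T.sum-cong-≗ {n} (λ b → ≡.trans
           (cong (cartesianProductWith T._·_ (Φ (f b) p)) (≡.sym (List.map-∘ q)))
           (cartesianProductWith-map T._·_ (φ (f b)) (φ (g b)) p q)) ⟩
    T.sum (λ b → cartesianProductWith (λ x y → φ (f b) x T.· φ (g b) y) p q)
      ≈⟨ T.sum-cartesianProductWith (λ b x y → φ (f b) x T.· φ (g b) y) (λ x y → φ F (x R.· bar y)) termwise p q ⟩
    cartesianProductWith (λ x y → φ F (x R.· bar y)) p q
      ≡⟨ map-cartesianProductWith (φ F) (λ x y → x R.· bar y) p q ⟨
    Φ F (cartesianProductWith (λ x y → x R.· bar y) p q)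
      ≡⟨ cong (λ xs → Φ F xs) (≡.trans
           (≡.sym (cartesianProductWith-map R._·_ (λ x → x) bar p q))
           (cong (λ xs → cartesianProductWith R._·_ xs (R.conj q)) (List.map-id p))) ⟩
    Φ F (cartesianProductWith R._·_ p (R.conj q)) ∎
    where
    open SetoidReasoning T.setoid
    bar : R.Term → R.Term
    bar (r , α , s) = r , α , s S.⁻¹

    termwise : ∀ x y → T.sum (λ b → [ φ (f b) x T.· φ (g b) y ]) T.≈ [ φ F (x R.· bar y) ]
    termwise (r , α , s) (r′ , β , t) =
      -- All these products share one monomial and the sign `Sign.+`, hence collect into a single
      -- term.
      T.≈-trans (T.sum-term λ b → r ℝ.* ι (f b s) ℝ.* (r′ ℝ.* ι (g b t))) (T.term (coefficients (λ b → f b s) (λ b → g b t) (h s t) r r′) ≡.refl)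

-- Matrix entries of the remrep

module MonomialRepresentation (S : SignedGroup c ℓ) {m : ℕ} .{{_ : NonZero m}} (π : Remrep S m) where
  private
    module S = SignedGroup S
  open SignedGroupHomomorphism π
  open IsGroupHomomorphism isGroupHomomorphism
  open MatrixOperations ℤ.+-*-rawRing
  open MatrixProperties ℤ.+-*-commutativeRing
  open MonomialMatrix

  P : S.Carrier → Matrix ℤ m
  P s = matrix ⟦ s ⟧

  P-neg : ∀ s → P (S.-1# S.∙ s) ≈ᴹ -ᴹ (P s)
  P-neg s i j = begin
    P (S.-1# S.∙ s) i j       ≡⟨ homo S.-1# s i j ⟩
    (P S.-1# *ᴹ P s) i j      ≡⟨ *ᴹ-congʳ {X = P S.-1#} {Y = -ᴹ 1ᴹ} (P s) -1#-homo i j ⟩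
    ((-ᴹ 1ᴹ) *ᴹ P s) i j      ≡⟨ -ᴹ-*ᴹˡ 1ᴹ (P s) i j ⟩
    ℤ.- (1ᴹ *ᴹ P s) i j       ≡⟨ cong ℤ.-_ (*ᴹ-identityˡ (P s) i j) ⟩
    ℤ.- P s i j               ∎
    where open ≡.≡-Reasoning

  -- The inverse of a monomial matrix in `SP m` is its transpose, so `P t ᵀ` is the image of
  -- `t S.⁻¹`.
  P-divide : ∀ s t → P s *ᴹ (P t ᵀ) ≈ᴹ P (s S.∙ t S.⁻¹)
  P-divide s t i j = ≡.sym (≡.trans (homo s (t S.⁻¹) i j)
    (*ᴹ-congˡ {Y = P (t S.⁻¹)} {Z = P t ᵀ} (P s) (⁻¹-homo t) i j))

  P-*-odd : (H : Matrix ℤ m) → ∀ i j → IsOdd S (λ s → (P s *ᴹ H) i j)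
  P-*-odd H i j = record
    { f-cong = λ {s} {t} s≈t → *ᴹ-congʳ {X = P s} {Y = P t} H (⟦⟧-cong s≈t) i j
    ; f-odd  = λ s → ≡.trans (*ᴹ-congʳ {X = P (S.-1# S.∙ s)} {Y = -ᴹ (P s)} H (P-neg s) i j)
                             (-ᴹ-*ᴹˡ (P s) H i j)
    }

  -- With `x = + m`, these are the functions through which the orthogonality of the given design is
  -- carried over to the new one.
  P-scaled-odd : ∀ x i j → IsOdd S (λ s → x ℤ.* P s i j)
  P-scaled-odd x i j = record
    { f-cong = λ s≈t → cong (x ℤ.*_) (⟦⟧-cong s≈t i j)
    ; f-odd  = λ s → ≡.trans (cong (x ℤ.*_) (P-neg s i j)) (≡.sym (ℤ.neg-distribʳ-* x (P s i j)))
    }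

-- Row `i` of `A` has exactly one nonzero entry, so the sum defining the product reduces to one
-- summand, a product of two numbers ±1.
monomial-*-±1 : {A H : Matrix ℤ m} → IsMonomial A → (∀ i j → H i j ≡ 1ℤ ⊎ H i j ≡ -1ℤ) →
  let open MatrixOperations ℤ.+-*-rawRing in
  ∀ i j → (A *ᴹ H) i j ≡ 1ℤ ⊎ (A *ᴹ H) i j ≡ -1ℤ
monomial-*-±1 {A = A} {H} monomial ±1 i j = Sum.map (≡.trans single) (≡.trans single) product
  where
  open IsMonomial monomial
  open MatrixOperations ℤ.+-*-rawRing using (_*ᴹ_)
  open SumProperties (CommutativeRing.+-commutativeMonoid ℤ.+-*-commutativeRing) using (sum-single)
  k = proj₁ (rows i)
  vanish : ∀ l → k ≢ l → A i l ≡ 0ℤ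
  vanish l k≢l with A i l ℤ.≟ 0ℤ
  ... | yes z = z
  ... | no nz = ⊥-elim (k≢l (proj₂ (proj₂ (rows i)) nz))
  single : (A *ᴹ H) i j ≡ A i k ℤ.* H k j
  single = sum-single (λ l → A i l ℤ.* H l j) k λ l k≢l → cong (ℤ._* H l j) (vanish l k≢l)
  product : A i k ℤ.* H k j ≡ 1ℤ ⊎ A i k ℤ.* H k j ≡ -1ℤ
  product with A i k | entries i k | proj₁ (proj₂ (rows i)) | H k j | ±1 k j
  ... | _ | inj₁ ≡.refl        | nz | _ | _           = ⊥-elim (nz ≡.refl)
  ... | _ | inj₂ (inj₁ ≡.refl) | _  | _ | inj₁ ≡.refl = inj₁ ≡.refl
  ... | _ | inj₂ (inj₁ ≡.refl) | _  | _ | inj₂ ≡.refl = inj₂ ≡.refl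
  ... | _ | inj₂ (inj₂ ≡.refl) | _  | _ | inj₁ ≡.refl = inj₂ ≡.refl
  ... | _ | inj₂ (inj₂ ≡.refl) | _  | _ | inj₂ ≡.refl = inj₁ ≡.refl

-- The orthogonal design and its Gram matrix

module Construction {n m k : ℕ} .{{_ : NonZero m}} (u : Fin k → ℕ) (S : SignedGroup c ℓ)
  (design : SOD S n k u) (π : Remrep S m) (hadamard : HadamardMatrix m) where
  private
    module S = SignedGroup S
    module ℝ = CommutativeRing ℝ
    module R where
      open SignedGroupRing S k public
      open SignedGroupRingProperties S k public
      open RawRing rawRing public using (_*_; 1#)
      open MatrixOperations rawRing public
    module T where
      open SignedGroupRing trivialSignedGroup k public
      open SignedGroupRingProperties trivialSignedGroup k public
      open RawRing rawRing public using (_*_; 1#)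
      open MatrixOperations rawRing public
  open SOD design
  open HadamardMatrix hadamard using (H) renaming (entries to H-±1; orthogonal to H-orthogonal)
  open MonomialRepresentation S π
  open Realization S k
  open IntegerEmbedding ℝ.ring using (ι)
  open RingProperties ℝ.ring using (-‿distribʳ-*)
  open SemiringMult ℝ.semiring using (×-comm-*) renaming (_×_ to _×ℝ_; ×-congʳ to ×ℝ-congʳ)
  open MatrixOperations ℤ.+-*-rawRing using () renaming (_*ᴹ_ to _*ℤ_; 1ᴹ to 1ℤᴹ)
  open MatrixProperties ℤ.+-*-commutativeRing using (gram)
    renaming (1ᴹ-diag to 1ℤᴹ-diag; 1ᴹ-off to 1ℤᴹ-off)
  open SumProperties T.+-commutativeMonoid using (sum-combine)
  open SignedGroupHomomorphism π using (⟦_⟧; isGroupHomomorphism)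
  open MonomialMatrix using (isMonomial)
  open IsGroupHomomorphism isGroupHomomorphism using (ε-homo; ⟦⟧-cong)
  open CommutativeMonoidSum (CommutativeRing.+-commutativeMonoid ℤ.+-*-commutativeRing)
    using () renaming (sum to sumℤ)
  open SetoidReasoning T.setoid

  PH : Fin m → Fin m → S.Carrier → ℤ
  PH a b s = (P s *ℤ H) a b

  mP : Fin m → Fin m → S.Carrier → ℤ
  mP a a′ s = + m ℤ.* P s a a′

  -- A single entry, in row `a` and column `b` of the matrix put in place of `X i j`. It is computed
  -- from the formal sum `X i j` itself, so that no representation as `ε x` has to be chosen.
  block : Fin m → Fin n → Fin m → Fin n → T.FormalSum
  block a i b j = Φ (PH a b) (X i j)

  -- The Hadamard index is the leading one, as the order `m ℕ.* n` suggests. Compared with replacing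
  -- each entry of `X` by a contiguous block, this permutes rows and columns by the same
  -- permutation.
  Y : Matrix T.FormalSum (m ℕ.* n)
  Y x y = block (quotient {m} n x) (remainder {m} n x) (quotient {m} n y) (remainder {m} n y)

  -- `Φ` leaves the sign in the real coefficient, whereas a design needs it in the group component;
  -- for `z = -1` the relation `sign` moves it there.
  signed-monomial : ∀ {z} → z ≡ 1ℤ ⊎ z ≡ -1ℤ → ∀ r α →
    ∃ λ δ → [ r ℝ.* ι z , α , Sign.+ ] T.≈ [ r , α , δ ]
  signed-monomial (inj₁ ≡.refl) r α = Sign.+ , T.term
    (ℝ.trans (ℝ.*-congˡ (ℝ.+-identityʳ _)) (ℝ.*-identityʳ r)) ≡.refl
  signed-monomial (inj₂ ≡.refl) r α = Sign.- , T.≈-trans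
    (T.term (ℝ.trans (ℝ.sym (-‿distribʳ-* r _))
      (ℝ.-‿cong (ℝ.trans (ℝ.*-congˡ (ℝ.+-identityʳ _)) (ℝ.*-identityʳ r)))) ≡.refl)
    (T.sign r α Sign.+)

  block-entries : ∀ a i b j →
    block a i b j T.≈ [] ⊎ ∃₂ λ δ l → block a i b j T.≈ T.⟨ δ ⟩ T.* T.var l
  block-entries a i b j = Sum.map realize
    (λ (ε , l , eq) →
      -- The product `⟨ ε ⟩ * var l` computes to one term with coefficient `1# * 1#` and group
      -- element `ε S.∙ S.ε`, which explains these arguments.
      let δ , δ-eq = signed-monomial (monomial-*-±1 (isMonomial ⟦ ε S.∙ S.ε ⟧) H-±1 a b) (ℝ.1# ℝ.* ℝ.1#) _
      in δ , l , T.≈-trans (realize eq) (T.≈-trans δ-eq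
           (T.term ℝ.refl (≡.sym (Sign.*-identityʳ δ)))))
    (entries i j)
    where
    realize : ∀ {q} → X i j R.≈ q → block a i b j T.≈ Φ (PH a b) q
    realize = Φ-cong (P-*-odd H a b)

  -- Orthogonality of `H` makes the sum depend on `s` and `t` only through their quotient, as
  -- `sum-Φ*` requires.
  PH-gram : ∀ a a′ s t → sumℤ (λ b → PH a b s ℤ.* PH a′ b t) ≡ mP a a′ (s S.∙ t S.⁻¹)
  PH-gram a a′ s t =
    ≡.trans (gram {x = + m} H-orthogonal (P s) (P t) a a′) (cong (+ m ℤ.*_) (P-divide s t a a′))

  -- YY* = m π(XX*), block by block
  Y-gram : ∀ a i a′ j →
    T.sum (λ b → T.sum λ l → block a i b l T.* T.conj (block a′ j b l))
      T.≈ Φ (mP a a′) ((X R.*ᴹ (X R.⋆)) i j)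
  Y-gram a i a′ j = begin
    T.sum (λ b → T.sum λ l → product b l)
      ≈⟨ T.∑-comm product ⟩
    T.sum (λ l → T.sum λ b → product b l)
      ≈⟨ T.sum-cong-≋ (λ l → sum-Φ* (PH a) (PH a′) (mP a a′) (PH-gram a a′) (X i l) (X j l)) ⟩
    T.sum (λ l → Φ (mP a a′) (X i l R.* R.conj (X j l)))
      ≡⟨ Additive.map-sum {S = S} {T = trivialSignedGroup} (Φ (mP a a′)) ≡.refl (List.map-++ _)
           (λ l → X i l R.* R.conj (X j l)) ⟨
    Φ (mP a a′) ((X R.*ᴹ (X R.⋆)) i j) ∎
    where
    product : Fin m → Fin n → T.FormalSum
    product b l = block a i b l T.* T.conj (block a′ j b l)

  v : Fin k → R.FormalSum
  v l = R.var l R.* R.var l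

  w : Fin k → T.FormalSum
  w l = T.var l T.* T.var l

  Q : R.FormalSum
  Q = R.sum λ l → u l R.× v l

  mQ : T.FormalSum
  mQ = T.sum λ l → (m ℕ.* u l) T.× w l

  -- `Q R.* R.1#` is literally a diagonal entry of `Q R.• R.1ᴹ`. The factor `R.1#` is kept: right
  -- multiplication by a fixed list distributes over `++` up to `≡`, so the composite with `Φ` is
  -- still additive.
  Φ-Q : ∀ a a′ → Φ (mP a a′) (Q R.* R.1#) ≡
    T.sum λ l → u l T.× Φ (mP a a′) (v l R.* R.1#)
  Φ-Q a a′ = Additive.map-combination (λ p → Φ (mP a a′) (p R.* R.1#))
    ≡.refl
    (λ p q → ≡.trans (cong (Φ (mP a a′)) (List.cartesianProductWith-distribʳ-++ R._·_ p q R.1#))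
                     (List.map-++ (φ (mP a a′)) (p R.* R.1#) _))
    u v

  -- The triple product is the group element of the only term of `v l R.* R.1#`, with one unit from
  -- each factor; the remrep sends it to the identity matrix.
  mP-ε : ∀ a a′ → mP a a′ (S.ε S.∙ S.ε S.∙ S.ε) ≡ + m ℤ.* 1ℤᴹ a a′
  mP-ε a a′ = cong (+ m ℤ.*_) (≡.trans
    (⟦⟧-cong (S.trans (S.identityʳ _) (S.identityʳ S.ε)) a a′) (ε-homo a a′))

  Φ-Q-diag : ∀ a → Φ (mP a a) (Q R.* R.1#) T.≈ mQ T.* T.1#
  Φ-Q-diag a = begin
    Φ (mP a a) (Q R.* R.1#)
      ≡⟨ Φ-Q a a ⟩
    T.sum (λ l → u l T.× Φ (mP a a) (v l R.* R.1#))
      -- The coefficient `m` of each image is read as `m` copies of a term, so the multiplicities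
      -- `u l` and `m` multiply.
      ≈⟨ T.sum-cong-≋ (λ l → T.≈-trans (T.×-congʳ (u l) (scale l)) (T.×-assocˡ (w′ l) (u l) m)) ⟩
    T.sum (λ l → (u l ℕ.* m) T.× w′ l)
      ≡⟨ T.sum-cong-≗ (λ l → cong (T._× w′ l) (ℕ.*-comm (u l) m)) ⟩
    T.sum (λ l → (m ℕ.* u l) T.× w′ l)
      ≡⟨ Additive.map-combination (λ p → p T.* T.1#) ≡.refl
           (λ p q → List.cartesianProductWith-distribʳ-++ T._·_ p q T.1#) (λ l → m ℕ.* u l) w ⟨
    mQ T.* T.1# ∎
    where
    w′ : Fin k → T.FormalSum
    w′ l = w l T.* T.1#
    coefficient : ∀ r → r ℝ.* ι (mP a a (S.ε S.∙ S.ε S.∙ S.ε)) ℝ.≈ m ×ℝ r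
    coefficient r = ℝ.trans
      (ℝ.*-congˡ (ℝ.reflexive (cong ι (≡.trans (mP-ε a a)
        (≡.trans (cong (+ m ℤ.*_) (1ℤᴹ-diag a)) (ℤ.*-identityʳ (+ m)))))))
      (ℝ.trans (×-comm-* m r ℝ.1#) (×ℝ-congʳ m (ℝ.*-identityʳ r)))
    scale : ∀ l → Φ (mP a a) (v l R.* R.1#) T.≈ m T.× w′ l
    scale l = T.≈-trans (T.term (coefficient _) ≡.refl) (T.≈-sym (T.×-term m _))

  -- The identity matrix vanishes at `a`, `a′`, so every term of the image has coefficient zero and
  -- is cancelled.
  Φ-Q-off : ∀ {a a′} → a ≢ a′ → Φ (mP a a′) (Q R.* R.1#) T.≈ []
  Φ-Q-off {a} {a′} a≢a′ = T.≈-trans (T.≡⇒≈ (Φ-Q a a′)) (T.sum-zero λ l → T.×-zeroʳ (u l)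
    (T.≈-trans (T.term (coefficient _) ≡.refl) (T.cancel _ _)))
    where
    coefficient : ∀ r → r ℝ.* ι (mP a a′ (S.ε S.∙ S.ε S.∙ S.ε)) ℝ.≈ ℝ.0#
    coefficient r = ℝ.trans
      (ℝ.*-congˡ (ℝ.reflexive (cong ι (≡.trans (mP-ε a a′)
        (≡.trans (cong (+ m ℤ.*_) (1ℤᴹ-off a≢a′)) (ℤ.*-zeroʳ (+ m)))))))
      (ℝ.zeroʳ r)

  mQ-off : {x x′ : Fin (m ℕ.* n)} → x ≢ x′ → [] ≡ (mQ T.• T.1ᴹ) x x′
  mQ-off x≢x′ = ≡.sym (≡.trans (cong (mQ T.*_) (T.1ᴹ-off x≢x′))
    (List.cartesianProductWith-zeroʳ T._·_ mQ))

  -- Both sides vanish unless `i = j` and `a = a′`. On the left the first condition comes from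
  -- `R.1ᴹ` and the second from the remrep at the unit; on the right both come from injectivity of
  -- `combine`.
  Φ-scalar : ∀ a i a′ j →
    Φ (mP a a′) ((Q R.• R.1ᴹ) i j) T.≈ (mQ T.• T.1ᴹ) (combine a i) (combine a′ j)
  Φ-scalar a i a′ j with i ≟ j | a ≟ a′
  ... | no i≢j     | _          = T.≡⇒≈ (≡.trans
    (cong (Φ (mP a a′)) (List.cartesianProductWith-zeroʳ R._·_ Q))
    (mQ-off λ eq → i≢j (combine-injectiveʳ a i a′ j eq)))
  ... | yes ≡.refl | no a≢a′    = T.≈-trans (Φ-Q-off a≢a′)
    (T.≡⇒≈ (mQ-off λ eq → a≢a′ (combine-injectiveˡ a i a′ i eq)))
  ... | yes ≡.refl | yes ≡.refl = T.≈-trans (Φ-Q-diag a)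
    (T.≡⇒≈ (cong (mQ T.*_) (≡.sym (T.1ᴹ-diag (combine a i)))))

  Y-combine : ∀ x b l → Y x (combine b l) ≡ block (quotient {m} n x) (remainder {m} n x) b l
  Y-combine x b l = cong (λ (b , l) → block (quotient {m} n x) (remainder {m} n x) b l)
    (remQuot-combine {m} {n} b l)

  Y-orthogonal : (Y T.*ᴹ (Y T.⋆)) T.≈ᴹ (mQ T.• T.1ᴹ)
  Y-orthogonal x x′ = begin
    (Y T.*ᴹ (Y T.⋆)) x x′
      ≈⟨ sum-combine m n (λ y → Y x y T.* T.conj (Y x′ y)) ⟩
    T.sum (λ (b : Fin m) → T.sum λ (l : Fin n) →
      Y x (combine b l) T.* T.conj (Y x′ (combine b l)))
      ≡⟨ T.sum-cong-≗ {m} (λ b → T.sum-cong-≗ {n} λ l →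
           cong₂ (λ p q → p T.* T.conj q) (Y-combine x b l) (Y-combine x′ b l)) ⟩
    T.sum (λ b → T.sum λ l → block a i b l T.* T.conj (block a′ j b l))
      ≈⟨ Y-gram a i a′ j ⟩
    Φ (mP a a′) ((X R.*ᴹ (X R.⋆)) i j)
      -- The orthogonality of `X` holds only up to `≈`; oddness of the entries of `m P` lets it pass
      -- through `Φ`.
      ≈⟨ Φ-cong (P-scaled-odd (+ m) a a′) (orthogonal i j) ⟩
    Φ (mP a a′) ((Q R.• R.1ᴹ) i j)
      ≈⟨ Φ-scalar a i a′ j ⟩
    (mQ T.• T.1ᴹ) (combine a i) (combine a′ j)
      -- The row indices, split into quotient and remainder at the start, are reassembled.
      ≡⟨ cong₂ (mQ T.• T.1ᴹ) (combine-remQuot {m} n x) (combine-remQuot {m} n x′) ⟩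
    (mQ T.• T.1ᴹ) x x′ ∎
    where
    a = quotient {m} n x
    i = remainder {m} n x
    a′ = quotient {m} n x′
    j = remainder {m} n x′

open import Data.Nat.Base using (_*_)

theorem4 : {c ℓ : Level} (n m k : ℕ) .{{_ : NonZero n}} .{{_ : NonZero m}} .{{_ : NonZero k}}
    (u : Fin k → ℕ) → (∀ l → NonZero (u l)) →
    (S : SignedGroup c ℓ) → SOD S n k u → Remrep S m → HadamardMatrix m →
    OD (m * n) k (λ l → m * u l)
theorem4 n m k u _ S design π hadamard = record
  { X          = Y
  ; entries    = λ x y → block-entries _ _ _ _
  ; orthogonal = Y-orthogonal
  }
  where open Construction u S design π hadamard
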